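{- Let $X$ be an $A^*$-automaton whose action is defined using functions distributively computable on a basic set. Then $X$ admits a refinement in an $A^*$-automaton whose action is defined using derived functions.
   Context: $A$ is an alphabet and $A^*$ is the free monoid on $A$. For a monoid $M$, an $M$-automaton is a set $X$ with a monoid action $M\times X\to X$, $(m,x)\mapsto m\cdot x$, with $m_2\cdot(m_1\cdot x)=(m_2m_1)\cdot x$ and $1\cdot x=x$. The action of an $A^*$-automaton is determined by the functions $x\mapsto a\cdot x$, $a\in A$; saying that it is defined using functions of a given class refers to these functions. The transition category $\mathbf{Trans}(X)$ has as objects the elements of $X$; arrows $x\to y$ are the $m\in M$ with $m\cdot x=y$ (an arrow being determined by $m$ together with its domain and codomain); composition is multiplication in $M$. A mapping from an $M$-automaton $X$ to an $N$-automaton $Y$ is a functor $\mathbf{Trans}(X)\to\mathbf{Trans}(Y)$. A refinement of $X$ in $Y$ is a mapping which is a full inclusion, i.e. a full and faithful functor injective on objects. Distributive computability. $I=\{*\}$, $+$ is disjoint union of sets, $\times$ is cartesian product. A family of basic sets and a family of basic functions (the "basic set" of functions) are fixed. Derived sets are obtained from the basic sets, $\varnothing$ and $I$ by repeated $+$ and $\times$; basic functions go between derived sets. Derived functions are obtained from the basic functions, injections into binary sums, projections from binary products, identities, initial maps $\varnothing\to Z$, terminal maps $Z\to I$ and inverse distributivity isomorphisms $X\times(Y+Z)\to X\times Y+X\times Z$, by repeated use of composition, $(f\mid g):X+Y\to Z$ (equal to $f$ on $X$ and $g$ on $Y$) and $(f,g):Z\to X\times Y$, $z\mapsto\langle f(z),g(z)\rangle$.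 If $f:X+U\to U+Y$ is a derived function such that for each $x\in X$ there is $n_x$ with $f^{n_x}(x)\in Y$ (start from $x$, apply $f$, and re-apply $f$ as long as the value lies in $U$), then $\mathbf{call}[f]:X\to Y$ is $x\mapsto f^{n_x}(x)$. Distributively computable functions are those of the form $\mathbf{call}[f]$, $f$ derived. -}

module Defs where

open import Level using (Level; _⊔_; suc; 0ℓ)
open import Algebra.Bundles using (Monoid)
open import Data.Empty using (⊥; ⊥-elim)
open import Data.List.Base using ([_])
open import Data.List.Properties using (++-monoid)
open import Data.Nat.Base as ℕ using (ℕ)
open import Data.Product.Base
  using (Σ-syntax; ∃-syntax; ∃₂; _×_; _,_; proj₁; proj₂; <_,_>)
open import Data.Sum.Base using (_⊎_; inj₁; inj₂; [_,_]′)
open import Data.Unit.Base using (⊤; tt)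
open import Function.Base using (_∘′_; id; const)
open import Function.Definitions using (Injective)
open import Relation.Binary.PropositionalEquality
  using (_≡_; sym; trans; cong; _≗_)
open import Relation.Binary.Structures using (IsEquivalence)

record Category (o ℓ e : Level) : Set (suc (o ⊔ ℓ ⊔ e)) where
  infix  4 _≈_
  infixr 9 _∘_
  field
    Obj       : Set o
    Hom       : Obj → Obj → Set ℓ
    _≈_       : ∀ {x y} → Hom x y → Hom x y → Set e
    idn       : ∀ {x} → Hom x x
    _∘_       : ∀ {x y z} → Hom y z → Hom x y → Hom x z
    equiv     : ∀ {x y} → IsEquivalence (_≈_ {x} {y})
    ∘-cong    : ∀ {x y z} {g g′ : Hom y z} {f f′ : Hom x y} →
                g ≈ g′ → f ≈ f′ → g ∘ f ≈ g′ ∘ f′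
    assoc     : ∀ {w x y z} {h : Hom y z} {g : Hom x y} {f : Hom w x} →
                (h ∘ g) ∘ f ≈ h ∘ (g ∘ f)
    identityˡ : ∀ {x y} {f : Hom x y} → idn ∘ f ≈ f
    identityʳ : ∀ {x y} {f : Hom x y} → f ∘ idn ≈ f

module _ {o ℓ e o′ ℓ′ e′ : Level}
         (C : Category o ℓ e) (D : Category o′ ℓ′ e′) where
  private
    module C = Category C
    module D = Category D

  record Functor : Set (o ⊔ ℓ ⊔ e ⊔ o′ ⊔ ℓ′ ⊔ e′) where
    field
      F₀     : C.Obj → D.Obj
      F₁     : ∀ {x y} → C.Hom x y → D.Hom (F₀ x) (F₀ y)
      F-cong : ∀ {x y} {f g : C.Hom x y} → f C.≈ g → F₁ f D.≈ F₁ g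
      F-id   : ∀ {x} → F₁ (C.idn {x}) D.≈ D.idn
      F-∘    : ∀ {x y z} {g : C.Hom y z} {f : C.Hom x y} →
               F₁ (g C.∘ f) D.≈ F₁ g D.∘ F₁ f

module _ {o ℓ e o′ ℓ′ e′ : Level}
         {C : Category o ℓ e} {D : Category o′ ℓ′ e′} where
  private
    module C = Category C
    module D = Category D

  Full : Functor C D → Set (o ⊔ ℓ ⊔ ℓ′ ⊔ e′)
  Full F = ∀ {x y} (g : D.Hom (F₀ x) (F₀ y)) → ∃[ f ] F₁ {x} {y} f D.≈ g
    where open Functor F

  Faithful : Functor C D → Set (o ⊔ ℓ ⊔ e ⊔ e′)
  Faithful F = ∀ {x y} {f g : C.Hom x y} → F₁ f D.≈ F₁ g → f C.≈ g
    where open Functor F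

  InjectiveOnObjects : Functor C D → Set (o ⊔ o′)
  InjectiveOnObjects F = Injective _≡_ _≡_ (Functor.F₀ F)

record Automaton {c ℓ x : Level} (M : Monoid c ℓ) (X : Set x)
       : Set (c ⊔ ℓ ⊔ x) where
  open Monoid M
  infixr 8 _·_
  field
    _·_     : Carrier → X → X
    ·-cong  : ∀ {m n} x → m ≈ n → m · x ≡ n · x
    ·-assoc : ∀ m₂ m₁ x → m₂ · (m₁ · x) ≡ (m₂ ∙ m₁) · x
    ·-id    : ∀ x → ε · x ≡ x

-- The proof that m · x ≡ y is ignored by the equality of arrows.
Trans : ∀ {c ℓ x} {M : Monoid c ℓ} {X : Set x} →
        Automaton M X → Category x (c ⊔ x) ℓ
Trans {M = M} {X = X} α = record
  { Obj       = X
  ; Hom       = λ x y → Σ[ m ∈ Carrier ] m · x ≡ y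
  ; _≈_       = λ f g → proj₁ f ≈ proj₁ g
  ; idn       = λ {x} → ε , ·-id x
  ; _∘_       = λ { {x} (n , q) (m , p) →
                    n ∙ m , trans (sym (·-assoc n m x)) (trans (cong (n ·_) p) q) }
  ; equiv     = record
    { refl  = M.refl
    ; sym   = M.sym
    ; trans = M.trans
    }
  ; ∘-cong    = ∙-cong
  ; assoc     = λ {_} {_} {_} {_} {h} {g} {f} → M.assoc (proj₁ h) (proj₁ g) (proj₁ f)
  ; identityˡ = λ {_} {_} {f} → M.identityˡ (proj₁ f)
  ; identityʳ = λ {_} {_} {f} → M.identityʳ (proj₁ f)
  }
  where
  module M = Monoid M
  open M using (Carrier; _≈_; _∙_; ε; ∙-cong)
  open Automaton α

module _ {c ℓ x c′ ℓ′ y : Level} {M : Monoid c ℓ} {N : Monoid c′ ℓ′}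
         {X : Set x} {Y : Set y} where

  Mapping : Automaton M X → Automaton N Y → Set (c ⊔ ℓ ⊔ x ⊔ c′ ⊔ ℓ′ ⊔ y)
  Mapping α β = Functor (Trans α) (Trans β)

  record Refinement (α : Automaton M X) (β : Automaton N Y)
         : Set (c ⊔ ℓ ⊔ x ⊔ c′ ⊔ ℓ′ ⊔ y) where
    field
      mapping   : Mapping α β
      full      : Full mapping
      faithful  : Faithful mapping
      injective : InjectiveOnObjects mapping

infix 10 _⋆

-- Words act from the left, so the rightmost letter of a word acts first.
_⋆ : Set → Monoid 0ℓ 0ℓ
A ⋆ = ++-monoid A

letter : ∀ {A X : Set} → Automaton (A ⋆) X → A → X → X
letter α a = Automaton._·_ α [ a ]

infixr 6 _+ᵈ_
infixr 7 _×ᵈ_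

-- Derived sets are expressions over the names of the basic sets.
data DerivedSet (B : Set) : Set where
  basic : B → DerivedSet B
  ∅ I   : DerivedSet B
  _+ᵈ_  : DerivedSet B → DerivedSet B → DerivedSet B
  _×ᵈ_  : DerivedSet B → DerivedSet B → DerivedSet B

El : ∀ {B : Set} → (B → Set) → DerivedSet B → Set
El S (basic b) = S b
El S ∅         = ⊥
El S I         = ⊤
El S (X +ᵈ Y)  = El S X ⊎ El S Y
El S (X ×ᵈ Y)  = El S X × El S Y

record Basics : Set₁ where
  field
    BasicSet : Set
    set      : BasicSet → Set
    BasicFun : DerivedSet BasicSet → DerivedSet BasicSet → Set
    fun      : ∀ {X Y} → BasicFun X Y → El set X → El set Y

-- f ↓[ n ] z ⇒ y says that fⁿ(z) is defined and equal to y ∈ Y, where f is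
-- re-applied exactly as long as the value lies in U.
data _↓[_]_⇒_ {X U Y : Set} (f : X ⊎ U → U ⊎ Y) : ℕ → X ⊎ U → Y → Set where
  stop  : ∀ {z y} → f z ≡ inj₂ y → f ↓[ 1 ] z ⇒ y
  again : ∀ {n z u y} → f z ≡ inj₁ u → f ↓[ n ] inj₂ u ⇒ y → f ↓[ ℕ.suc n ] z ⇒ y

Terminating : ∀ {X U Y : Set} → (X ⊎ U → U ⊎ Y) → Set
Terminating f = ∀ x → ∃₂ λ n y → f ↓[ n ] inj₁ x ⇒ y

call[_] : ∀ {X U Y : Set} (f : X ⊎ U → U ⊎ Y) → Terminating f → X → Y
call[ f ] t x = proj₁ (proj₂ (t x))

module Distributive (𝓑 : Basics) where
  open Basics 𝓑

  DSet : Set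
  DSet = DerivedSet BasicSet

  ⟦_⟧ : DSet → Set
  ⟦_⟧ = El set

  infixr 9 _∘ᵈ_

  data Term : DSet → DSet → Set where
    basic   : ∀ {X Y} → BasicFun X Y → Term X Y
    inl     : ∀ {X Y} → Term X (X +ᵈ Y)
    inr     : ∀ {X Y} → Term Y (X +ᵈ Y)
    fst     : ∀ {X Y} → Term (X ×ᵈ Y) X
    snd     : ∀ {X Y} → Term (X ×ᵈ Y) Y
    idᵈ     : ∀ {X} → Term X X
    initial : ∀ {Z} → Term ∅ Z
    final   : ∀ {Z} → Term Z I
    distr⁻¹ : ∀ {X Y Z} → Term (X ×ᵈ (Y +ᵈ Z)) (X ×ᵈ Y +ᵈ X ×ᵈ Z)
    _∘ᵈ_    : ∀ {X Y Z} → Term Y Z → Term X Y → Term X Z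
    copair  : ∀ {X Y Z} → Term X Z → Term Y Z → Term (X +ᵈ Y) Z
    pair    : ∀ {X Y Z} → Term Z X → Term Z Y → Term Z (X ×ᵈ Y)

  eval : ∀ {X Y} → Term X Y → ⟦ X ⟧ → ⟦ Y ⟧
  eval (basic f)    = fun f
  eval inl          = inj₁
  eval inr          = inj₂
  eval fst          = proj₁
  eval snd          = proj₂
  eval idᵈ          = id
  eval initial      = ⊥-elim
  eval final        = const tt
  eval distr⁻¹      = λ { (x , inj₁ y) → inj₁ (x , y) ; (x , inj₂ z) → inj₂ (x , z) }
  eval (g ∘ᵈ f)     = eval g ∘′ eval f
  eval (copair f g) = [ eval f , eval g ]′
  eval (pair f g)   = < eval f , eval g >

  Derived : ∀ X Y → (⟦ X ⟧ → ⟦ Y ⟧) → Set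
  Derived X Y f = Σ[ t ∈ Term X Y ] eval t ≗ f

  Computable : ∀ X Y → (⟦ X ⟧ → ⟦ Y ⟧) → Set
  Computable X Y g =
    Σ[ U ∈ DSet ]
    Σ[ f ∈ (⟦ X +ᵈ U ⟧ → ⟦ U +ᵈ Y ⟧) ]
      Derived (X +ᵈ U) (U +ᵈ Y) f ×
      (Σ[ t ∈ Terminating f ] call[ f ] t ≗ g)

{-# OPTIONS --safe #-}

-- Letter a performs one application of the loop body of a: it enters the loop
-- from a state in X and continues it from a state in U a, while any other
-- letter met inside the loop of a leads to an absorbing dead state.  An arrow
-- labelled by a from x becomes the power of a whose exponent is the length of
-- the computation.  The dead state makes this full, since a word leading from
-- X to X has no choice but to complete each loop it enters, and the original
-- word is recovered by recording the letters at which the run returns to X.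

module Submission where

open import Defs
open import Data.Fin.Base using (Fin)
open import Data.Fin.Properties using (inj⇒≟)
open import Data.List.Base
  using (List; []; _∷_; [_]; _++_; _ʳ++_; foldr; map; replicate; allFin)
open import Data.List.Membership.Propositional using (_∈_)
open import Data.List.Membership.Propositional.Properties using (∈-map⁺; ∈-allFin)
open import Data.List.Properties using (foldr-++)
open import Data.List.Relation.Unary.Any using (here; there)
open import Data.Nat.Base using (ℕ)
open import Data.Product.Base using (Σ-syntax; ∃-syntax; _×_; _,_; proj₁; proj₂)
open import Data.Sum.Base using (_⊎_; inj₁; inj₂; [_,_]′)
open import Data.Sum.Properties using (inj₁-injective)
open import Data.Unit.Base using (tt)
open import Function.Bundles using (_↔_; Inverse)
open import Function.Properties.Inverse using (↔⇒↣)
open import Relation.Binary.Definitions using (DecidableEquality)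
open import Relation.Binary.PropositionalEquality
  using (_≡_; _≢_; _≗_; refl; sym; trans; cong; subst)
open import Relation.Nullary.Decidable using (Dec; yes; no)
open import Relation.Nullary.Negation using (contradiction)

-- A computable function comes with a term that agrees with its loop body only pointwise; this
-- carries the halting runs over to the evaluated term.
↓-cong : ∀ {X U Y : Set} {f g : X ⊎ U → U ⊎ Y} → f ≗ g →
         ∀ {n z y} → f ↓[ n ] z ⇒ y → g ↓[ n ] z ⇒ y
↓-cong f≗g (stop e)    = stop (trans (sym (f≗g _)) e)
↓-cong f≗g (again e r) = again (trans (sym (f≗g _)) e) (↓-cong f≗g r)

ʳ++-++ : ∀ {A : Set} (xs : List A) {ys zs} → (xs ʳ++ ys) ++ zs ≡ xs ʳ++ (ys ++ zs)
ʳ++-++ []       = refl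
ʳ++-++ (x ∷ xs) = ʳ++-++ xs

freeAction : ∀ {A X : Set} → (A → X → X) → Automaton (A ⋆) X
freeAction δ = record
  { _·_     = λ w x → foldr δ x w
  ; ·-cong  = λ { x refl → refl }
  ; ·-assoc = λ v w x → sym (foldr-++ δ x v w)
  ; ·-id    = λ x → refl
  }

module _ (𝓑 : Basics) where
  open Distributive 𝓑

  module _ {A : Set} (U : A → DSet) where

    -- Derived sets have only binary sums, so the loop sets are summed along a list, which a finite
    -- alphabet provides.
    ⨁ : List A → DSet
    ⨁ []       = ∅
    ⨁ (a ∷ as) = U a +ᵈ ⨁ as

    ι : ∀ {a as} → a ∈ as → Term (U a) (⨁ as)
    ι (here refl) = inl
    ι (there p)   = inr ∘ᵈ ι p

    cotuple : ∀ {Z} → (∀ a → Term (U a) Z) → ∀ as → Term (⨁ as) Z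
    cotuple h []       = initial
    cotuple h (a ∷ as) = copair (h a) (cotuple h as)

    cotuple-ι : ∀ {Z} (h : ∀ a → Term (U a) Z) {a as} (p : a ∈ as) u →
                eval (cotuple h as) (eval (ι p) u) ≡ eval (h a) u
    cotuple-ι h (here refl) u = refl
    cotuple-ι h (there p)   u = cotuple-ι h p u

  module StepwiseExecution
    {A : Set} (_≟_ : DecidableEquality A) (as : List A) (∈as : ∀ a → a ∈ as)
    (X : DSet) (α : Automaton (A ⋆) ⟦ X ⟧)
    (U : A → DSet) (body : ∀ a → Term (X +ᵈ U a) (U a +ᵈ X))
    (loop : ∀ a x → ∃[ n ] eval (body a) ↓[ n ] inj₁ x ⇒ letter α a x)
    where

    open Automaton α

    Y : DSet
    Y = X +ᵈ ⨁ U as +ᵈ I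

    pattern dead = inj₂ (inj₂ tt)

    exit : ∀ a → Term (U a +ᵈ X) Y
    exit a = copair (inr ∘ᵈ inl ∘ᵈ ι U (∈as a)) inl

    enter : ∀ a → Term X Y
    enter a = exit a ∘ᵈ body a ∘ᵈ inl

    -- With the decision as an argument, later proofs can abstract `a ≟ b` and let the term reduce.
    resumeIf : ∀ a b → Dec (a ≡ b) → Term (U b) Y
    resumeIf a .a (yes refl) = exit a ∘ᵈ body a ∘ᵈ inr
    resumeIf a b  (no _)     = inr ∘ᵈ inr ∘ᵈ final

    resume : ∀ a b → Term (U b) Y
    resume a b = resumeIf a b (a ≟ b)

    step : A → Term Y Y
    step a = copair (enter a) (copair (cotuple U (resume a) as) (inr ∘ᵈ inr))

    β : Automaton (A ⋆) ⟦ Y ⟧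
    β = freeAction (λ a → eval (step a))

    open Automaton β using () renaming (_·_ to _·ᵝ_)

    inLoop : ∀ a → ⟦ U a ⟧ → ⟦ Y ⟧
    inLoop a u = inj₂ (inj₁ (eval (ι U (∈as a)) u))

    embed : ∀ a → ⟦ X +ᵈ U a ⟧ → ⟦ Y ⟧
    embed a = [ inj₁ , inLoop a ]′

    -- Entering a loop and continuing it become one case, so runs can be followed by induction
    -- without treating the first iteration apart.
    step-embed : ∀ a z → eval (step a) (embed a z) ≡ eval (exit a) (eval (body a) z)
    step-embed a (inj₁ x) = refl
    step-embed a (inj₂ u) with a ≟ a | cotuple-ι U (resume a) (∈as a) u
    ... | yes refl | e = e
    ... | no a≢a   | _ = contradiction refl a≢a

    step-inLoop-≢ : ∀ {a b} → a ≢ b → ∀ u → eval (step a) (inLoop b u) ≡ dead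
    step-inLoop-≢ {a} {b} a≢b u with a ≟ b | cotuple-ι U (resume a) (∈as b) u
    ... | yes a≡b | _ = contradiction a≡b a≢b
    ... | no _    | e = e

    step-embed-↦ : ∀ {a z v} → eval (body a) z ≡ v →
                   eval (step a) (embed a z) ≡ eval (exit a) v
    step-embed-↦ {a} {z} e = trans (step-embed a z) (cong (eval (exit a)) e)

    ∷-· : ∀ a m x → (a ∷ m) · x ≡ letter α a (m · x)
    ∷-· a m x = sym (·-assoc [ a ] m x)

    -- Reversal is invisible on a constant list. `ʳ++` pushes one letter at a time onto the word
    -- already read, as a run does, so moving a letter across holds by computation.
    expand : ⟦ X ⟧ → List A → List A
    expand x []      = []
    expand x (a ∷ m) = replicate (proj₁ (loop a (m · x))) a ʳ++ expand x m

    expand-++ : ∀ x m n → expand x (m ++ n) ≡ expand (n · x) m ++ expand x n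
    expand-++ x []      n = refl
    expand-++ x (a ∷ m) n
      rewrite sym (·-assoc m n x) | expand-++ x m n
      = sym (ʳ++-++ (replicate (proj₁ (loop a (m · n · x))) a))

    ∷-ifReturned : A → ⟦ Y ⟧ → List A → List A
    ∷-ifReturned a (inj₁ _) m = a ∷ m
    ∷-ifReturned a (inj₂ _) m = m

    decode : ⟦ X ⟧ → List A → List A
    decode x []      = []
    decode x (a ∷ w) = ∷-ifReturned a ((a ∷ w) ·ᵝ inj₁ x) (decode x w)

    -- Induction on the run, from any point of it, since `again` resumes in `U a`. Only the last of
    -- the `n` letters leads back to `X`, so `decode` keeps just that one.
    complete : ∀ {a n z y} x w → eval (body a) ↓[ n ] z ⇒ y → w ·ᵝ inj₁ x ≡ embed a z →
               (replicate n a ʳ++ w) ·ᵝ inj₁ x ≡ inj₁ y ×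
               decode x (replicate n a ʳ++ w) ≡ a ∷ decode x w
    complete {a} x w (stop e) s = aw , cong (λ v → ∷-ifReturned a v (decode x w)) aw
      where
      aw = trans (cong (eval (step a)) s) (step-embed-↦ e)
    complete {a} x w (again e r) s =
      proj₁ rest ,
      trans (proj₂ rest) (cong (λ v → a ∷ ∷-ifReturned a v (decode x w)) aw)
      where
      aw   = trans (cong (eval (step a)) s) (step-embed-↦ e)
      rest = complete x (a ∷ w) r aw

    expand-· : ∀ x m → expand x m ·ᵝ inj₁ x ≡ inj₁ (m · x)
    expand-· x []      = cong inj₁ (sym (·-id x))
    expand-· x (a ∷ m) = trans
      (proj₁ (complete x (expand x m) (proj₂ (loop a (m · x))) (expand-· x m)))
      (cong inj₁ (sym (∷-· a m x)))

    decode-expand : ∀ x m → decode x (expand x m) ≡ m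
    decode-expand x []      = refl
    decode-expand x (a ∷ m) = trans
      (proj₂ (complete x (expand x m) (proj₂ (loop a (m · x))) (expand-· x m)))
      (cong (a ∷_) (decode-expand x m))

    -- The invariant behind fullness. Inside a loop, the word read so far is an expansion still
    -- lacking `n` letters, `n` being the length of the remaining run. `died` records nothing, as no
    -- letter leaves `dead`.
    data Reached (x : ⟦ X ⟧) (w : List A) : ⟦ Y ⟧ → Set where
      returned : ∀ m → expand x m ≡ w → Reached x w (inj₁ (m · x))
      looping  : ∀ {a n u} m → eval (body a) ↓[ n ] inj₂ u ⇒ letter α a (m · x) →
                 expand x (a ∷ m) ≡ replicate n a ʳ++ w → Reached x w (inLoop a u)
      died     : Reached x w dead

    advance : ∀ {a n z} x w m → eval (body a) ↓[ n ] z ⇒ letter α a (m · x) →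
              expand x (a ∷ m) ≡ replicate n a ʳ++ w →
              Reached x (a ∷ w) (eval (step a) (embed a z))
    advance {a} x w m (stop e) q = subst (Reached x (a ∷ w))
      (trans (cong inj₁ (∷-· a m x)) (sym (step-embed-↦ e)))
      (returned (a ∷ m) q)
    advance {a} x w m (again e r) q = subst (Reached x (a ∷ w))
      (sym (step-embed-↦ e)) (looping m r q)

    reached-step : ∀ {x w y} a → Reached x w y → Reached x (a ∷ w) (eval (step a) y)
    reached-step {x} {w} a (returned m refl) =
      -- The loop is only being entered: all its iterations remain, and the required equation is the
      -- definition of `expand`.
      advance x w m (proj₂ (loop a (m · x))) refl
    reached-step {x} {w} a (looping {b} {u = u} m r q) with a ≟ b
    ... | yes refl = advance x w m r q
    ... | no a≢b   = subst (Reached x (a ∷ w)) (sym (step-inLoop-≢ a≢b u)) died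
    reached-step a died = died

    reached : ∀ x w → Reached x w (w ·ᵝ inj₁ x)
    reached x []      = subst (Reached x []) (cong inj₁ (·-id x)) (returned [] refl)
    reached x (a ∷ w) = reached-step a (reached x w)

    -- Freeing the index to a variable `v` permits matching; the equation then rules out `looping`
    -- and `died`.
    reached-inj₁ : ∀ {x w v y} → Reached x w v → v ≡ inj₁ y →
                   ∃[ m ] m · x ≡ y × expand x m ≡ w
    reached-inj₁ (returned m q) e = m , inj₁-injective e , q

    refinement : Refinement α β
    refinement = record
      { mapping   = record
        { F₀     = inj₁
        ; F₁     = λ { {x} (m , e) → expand x m , trans (expand-· x m) (cong inj₁ e) }
        ; F-cong = λ { {x} e → cong (expand x) e }
        ; F-id   = refl
        -- Matching on `refl` makes the middle object `m · x`, the state from which `expand-++`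
        -- expands `n`.
        ; F-∘    = λ { {x} {g = n , _} {m , refl} → expand-++ x n m }
        }
      ; full      = λ { {x} (w , e) →
          let m , p , q = reached-inj₁ (reached x w) e in (m , p) , q }
      -- Parallel arrows share the domain `x`, so the same `decode x` undoes both expansions.
      ; faithful  = λ { {x} {f = m , _} {n , _} e →
          trans (sym (decode-expand x m)) (trans (cong (decode x) e) (decode-expand x n)) }
      ; injective = inj₁-injective
      }

theorem13 : (𝓑 : Basics) → let open Distributive 𝓑 in
    (A : Set) (k : ℕ) → A ↔ Fin k →
    (X : DSet) (α : Automaton (A ⋆) ⟦ X ⟧) →
    (∀ a → Computable X X (letter α a)) →
    Σ[ Y ∈ DSet ] Σ[ β ∈ Automaton (A ⋆) ⟦ Y ⟧ ]
    (∀ a → Derived Y Y (letter β a)) × Refinement α β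
theorem13 𝓑 A k A↔Fin X α computable =
  Y , β , (λ a → step a , λ _ → refl) , refinement
  where
  open Distributive 𝓑
  open Inverse A↔Fin using (to; from; strictlyInverseʳ)

  U : A → DSet
  U a = proj₁ (computable a)

  body : ∀ a → Term (X +ᵈ U a) (U a +ᵈ X)
  body a = let _ , _ , (t , _) , _ = computable a in t

  loop : ∀ a x → ∃[ n ] eval (body a) ↓[ n ] inj₁ x ⇒ letter α a x
  loop a x with computable a
  ... | _ , _ , (_ , t≗f) , terminates , call≗a with terminates x | call≗a x
  -- `refl` identifies the value of the call with `letter α a x`, so `r` ends there.
  ...   | n , _ , r | refl = n , ↓-cong (λ z → sym (t≗f z)) r

  letters : List A
  letters = map from (allFin k)

  ∈letters : ∀ a → a ∈ letters
  ∈letters a = subst (_∈ letters) (strictlyInverseʳ a) (∈-map⁺ from (∈-allFin (to a)))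

  open StepwiseExecution 𝓑 (inj⇒≟ (↔⇒↣ A↔Fin)) letters ∈letters X α U body loop
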